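{- Let $p$ be a prime and $n\ge k\ge 1$ integers such that $s(n,k)$ is a minimum zero case, and let $r=(n-k)/(p-1)$. Then \[ \nu_p(s(n,k))=\frac{\sigma_p(k-1)-\sigma_p(n-1)}{p-1} \] and \[ \epsilon_p(s(n,k))\equiv \epsilon_p\big((n-1)!/(k-1)!\big)\binom{k-1}{r} \pmod p. \]
   Context: $s(n,k)$ is the signed Stirling number of the first kind, defined by $x(x-1)\cdots(x-n+1)=\sum_k s(n,k)x^k$. $\nu_p$ is the $p$-adic valuation, $\sigma_p(m)$ the base-$p$ digit sum, and $\epsilon_p(x)=p^{ -\nu_p(x)}x$ the unit part of a nonzero rational $x$. $s(n,k)$ is called a minimum zero case if $\nu_p(s(n,k))=(\sigma_p(k-1)-\sigma_p(n-1))/(p-1)$ (in this case $(p-1)\mid(n-k)$, so $r$ is a nonnegative integer). -}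

module Defs where

open import Data.Nat as ℕ using (ℕ; zero; suc; _∸_; _!)
open import Data.Nat.Divisibility using (_∣?_)
open import Data.Nat.DivMod using (_/_; _%_)
open import Data.Integer as ℤ using (ℤ; +_; _-_; _*_; ∣_∣; sign; _◃_)
open import Data.Integer.Divisibility as ℤD using ()
open import Relation.Nullary using (yes; no)

-- Signed Stirling numbers of the first kind:
-- x(x-1)...(x-n+1) = Σ_k s(n,k) x^k, hence
-- s(n+1,k+1) = s(n,k) - n * s(n,k+1).
stirling₁ : ℕ → ℕ → ℤ
stirling₁ zero    zero    = + 1
stirling₁ zero    (suc k) = + 0
stirling₁ (suc n) zero    = + 0
stirling₁ (suc n) (suc k) = stirling₁ n k - (+ n) * stirling₁ n (suc k)

-- p-adic valuation of a natural number (meaningful for p ≥ 2 and m ≠ 0;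
-- the fuel m is always sufficient since ν_p(m) < m for m ≥ 1).
νℕ : ℕ → ℕ → ℕ
νℕ zero          m = 0
νℕ (suc zero)    m = 0
νℕ (suc (suc q)) m = go m m
  where
  go : ℕ → ℕ → ℕ
  go zero    _       = 0
  go (suc f) zero    = 0
  go (suc f) (suc m) with suc (suc q) ∣? suc m
  ... | yes _ = suc (go f (suc m / suc (suc q)))
  ... | no  _ = 0

-- p-free part of a natural number: m / p^{ν_p(m)} (for p ≥ 2, m ≠ 0).
unitℕ : ℕ → ℕ → ℕ
unitℕ zero          m = m
unitℕ (suc zero)    m = m
unitℕ (suc (suc q)) m = go m m
  where
  go : ℕ → ℕ → ℕ
  go zero    m       = m
  go (suc f) zero    = zero
  go (suc f) (suc m) with suc (suc q) ∣? suc m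
  ... | yes _ = go f (suc m / suc (suc q))
  ... | no  _ = suc m

ν : ℕ → ℤ → ℕ
ν p x = νℕ p ∣ x ∣

ε : ℕ → ℤ → ℤ
ε p x = sign x ◃ unitℕ p ∣ x ∣

-- base-p digit sum (for p ≥ 2; fuel m suffices)
σ : ℕ → ℕ → ℕ
σ zero          m = m
σ (suc zero)    m = m
σ (suc (suc q)) m = go m m
  where
  go : ℕ → ℕ → ℕ
  go zero    _ = 0
  go (suc f) m = (m % suc (suc q)) ℕ.+ go f (m / suc (suc q))

_≡_[modℤ_] : ℤ → ℤ → ℕ → Set
a ≡ b [modℤ p ] = (+ p) ℤD.∣ (a - b)

{-# OPTIONS --safe #-}
-- Write N = n − 1, K = k − 1 and F = N! / K!.  The recurrence s(N+1, K+1) = s(N, K) − N s(N, K+1)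
-- and the expansion log(1+x)ᴷ = Σ K! s(m, K) xᵐ / m! reduce everything to powers of the logarithm.
-- The coefficient ±1/i of xⁱ in log(1+x) has valuation at least −⌊(i−1)/(p−1)⌋, and
-- among i ≡ 1 mod p − 1 equality holds only for i = 1 and i = p.  Hence, after scaling
-- by p^⌊(m−K)/(p−1)⌋, the powers of log(1+x) behave modulo p like those of x + xᵖ/p, whence the
-- binomial coefficient: pʳ s(n, k) ≡ F · C(K, r) modulo p F in the localisation at p.
-- Legendre's formula turns the minimum zero condition into ν(F) = ν(s(n, k)) + r, so that dividing
-- by p^ν(F) leaves the congruence of unit parts.

module Submission where

open import Defs

-- Powers of log(1+x) and binomial convolution.

module LogarithmPowers where
  open import Data.Nat.Base as ℕ using (ℕ; zero; suc; _!)
  import Data.Nat.Properties as ℕₚ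
  open import Data.Integer.Base using (ℤ; +_; _+_; _*_; _-_; -_; 0ℤ; 1ℤ; -1ℤ; _^_)
  open import Data.Integer.Properties
  open import Data.Integer.Tactic.RingSolver using (solve-∀)
  open import Relation.Binary.PropositionalEquality

  antidiagonal : (ℕ → ℕ → ℤ) → ℕ → ℤ
  antidiagonal F zero    = F 0 0
  antidiagonal F (suc n) = F 0 (suc n) + antidiagonal (λ i j → F (suc i) j) n

  antidiagonal-cong : ∀ {F G} n → (∀ i j → i ℕ.+ j ≡ n → F i j ≡ G i j) →
                      antidiagonal F n ≡ antidiagonal G n
  antidiagonal-cong zero    h = h 0 0 refl
  antidiagonal-cong (suc n) h =
    cong₂ _+_ (h 0 (suc n) refl)
              (antidiagonal-cong n (λ i j e → h (suc i) j (cong suc e)))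

  antidiagonal-+ : ∀ F G n → antidiagonal (λ i j → F i j + G i j) n ≡
                             antidiagonal F n + antidiagonal G n
  antidiagonal-+ F G zero    = refl
  antidiagonal-+ F G (suc n) =
    trans (cong (λ x → F 0 (suc n) + G 0 (suc n) + x) (antidiagonal-+ (λ i j → F (suc i) j) (λ i j → G (suc i) j) n))
          (interchange (F 0 (suc n)) (G 0 (suc n)) _ _)
    where
    interchange : ∀ a b c d → (a + b) + (c + d) ≡ (a + c) + (b + d)
    interchange = solve-∀

  antidiagonal-* : ∀ c F n → antidiagonal (λ i j → c * F i j) n ≡ c * antidiagonal F n
  antidiagonal-* c F zero    = refl
  antidiagonal-* c F (suc n) =
    trans (cong (λ x → c * F 0 (suc n) + x) (antidiagonal-* c (λ i j → F (suc i) j) n))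
          (sym (*-distribˡ-+ c (F 0 (suc n)) _))

  antidiagonal-last : ∀ F n → antidiagonal F (suc n) ≡
                              antidiagonal (λ i j → F i (suc j)) n + F (suc n) 0
  antidiagonal-last F zero    = refl
  antidiagonal-last F (suc n) =
    trans (cong (λ x → F 0 (suc (suc n)) + x) (antidiagonal-last (λ i j → F (suc i) j) n))
          (sym (+-assoc (F 0 (suc (suc n))) _ _))

  -- Kronecker delta by recursion instead of a decision, so that shifting both indices is a
  -- computation; `antidiagonal-indicator` rests on this.
  indicator : ℕ → ℕ → ℤ
  indicator zero    zero    = 1ℤ
  indicator zero    (suc i) = 0ℤ
  indicator (suc s) zero    = 0ℤ
  indicator (suc s) (suc i) = indicator s i

  indicator-refl : ∀ s → indicator s s ≡ 1ℤ
  indicator-refl zero    = refl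
  indicator-refl (suc s) = indicator-refl s

  indicator-≢ : ∀ s i → i ≢ s → indicator s i ≡ 0ℤ
  indicator-≢ zero    zero    i≢s with () ← i≢s refl
  indicator-≢ zero    (suc i) i≢s = refl
  indicator-≢ (suc s) zero    i≢s = refl
  indicator-≢ (suc s) (suc i) i≢s = indicator-≢ s i (λ e → i≢s (cong suc e))

  antidiagonal-0 : ∀ n → antidiagonal (λ _ _ → 0ℤ) n ≡ 0ℤ
  antidiagonal-0 zero    = refl
  antidiagonal-0 (suc n) = trans (+-identityˡ _) (antidiagonal-0 n)

  antidiagonal-indicator : ∀ s n (h : ℕ → ℤ) →
    antidiagonal (λ i j → indicator s i * h j) (s ℕ.+ n) ≡ h n
  antidiagonal-indicator zero    zero    h = *-identityˡ (h 0)
  antidiagonal-indicator zero    (suc n) h =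
    trans (cong₂ _+_ (*-identityˡ (h (suc n))) (antidiagonal-0 n)) (+-identityʳ _)
  antidiagonal-indicator (suc s) n       h =
    trans (+-identityˡ _) (antidiagonal-indicator s n h)

  -- The binomial coefficient C(i + j, i).
  binomial : ℕ → ℕ → ℤ
  binomial zero    j       = 1ℤ
  binomial (suc i) zero    = 1ℤ
  binomial (suc i) (suc j) = binomial i (suc j) + binomial (suc i) j

  fact : ℕ → ℤ
  fact n = + (n !)

  fact-suc : ∀ n → fact (suc n) ≡ + suc n * fact n
  fact-suc n = pos-* (suc n) (n !)

  -- Keeps divisibility by factorials stable under convolution: factors divisible by i! and j! give
  -- a term divisible by (i + j)!.
  binomial-fact : ∀ i j → binomial i j * (fact i * fact j) ≡ fact (i ℕ.+ j)
  binomial-fact zero    j       = trans (*-identityˡ _) (*-identityˡ _)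
  binomial-fact (suc i) zero    =
    trans (*-identityˡ _) (trans (*-identityʳ _) (cong (λ m → fact (suc m)) (sym (ℕₚ.+-identityʳ i))))
  binomial-fact (suc i) (suc j) = begin
    (binomial i (suc j) + binomial (suc i) j) * (fact (suc i) * fact (suc j))
      ≡⟨ *-distribʳ-+ _ (binomial i (suc j)) (binomial (suc i) j) ⟩
    binomial i (suc j) * (fact (suc i) * fact (suc j)) + binomial (suc i) j * (fact (suc i) * fact (suc j))
      ≡⟨ cong₂ (λ a b → binomial i (suc j) * (a * fact (suc j)) + binomial (suc i) j * (fact (suc i) * b))
               (fact-suc i) (fact-suc j) ⟩
    binomial i (suc j) * ((+ suc i * fact i) * fact (suc j))
      + binomial (suc i) j * (fact (suc i) * (+ suc j * fact j))
      ≡⟨ regroup (binomial i (suc j)) (+ suc i) (fact i) (fact (suc j)) (binomial (suc i) j) (fact (suc i)) (+ suc j) (fact j) ⟩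
    + suc i * (binomial i (suc j) * (fact i * fact (suc j)))
      + + suc j * (binomial (suc i) j * (fact (suc i) * fact j))
      ≡⟨ cong₂ (λ a b → + suc i * a + + suc j * b) (binomial-fact i (suc j)) (binomial-fact (suc i) j) ⟩
    + suc i * fact (i ℕ.+ suc j) + + suc j * fact (suc (i ℕ.+ j))
      ≡⟨ cong (λ m → + suc i * fact (i ℕ.+ suc j) + + suc j * fact m) (sym (ℕₚ.+-suc i j)) ⟩
    + suc i * fact (i ℕ.+ suc j) + + suc j * fact (i ℕ.+ suc j)
      ≡⟨ sym (*-distribʳ-+ (fact (i ℕ.+ suc j)) (+ suc i) (+ suc j)) ⟩
    + (suc i ℕ.+ suc j) * fact (i ℕ.+ suc j)
      ≡⟨ sym (fact-suc (i ℕ.+ suc j)) ⟩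
    fact (suc i ℕ.+ suc j) ∎
    where
    open ≡-Reasoning
    regroup : ∀ b x f f₁ c g₁ y g → b * ((x * f) * f₁) + c * (g₁ * (y * g)) ≡
                                    x * (b * (f * f₁)) + y * (c * (g₁ * g))
    regroup = solve-∀

  -- Pascal's rule turns the shift of a sequence (the derivative of its exponential
  -- generating function) into a derivation of binomial convolution.
  antidiagonal-pascal : ∀ (h : ℕ → ℕ → ℤ) n →
    antidiagonal (λ i j → binomial i j * h i j) (suc n) ≡
    antidiagonal (λ i j → binomial i j * (h (suc i) j + h i (suc j))) n
  antidiagonal-pascal h n = begin
    antidiagonal (λ i j → binomial i j * h i j) (suc n)
      ≡⟨ antidiagonal-cong (suc n) split ⟩
    antidiagonal (λ i j → left i j + right i j) (suc n)
      ≡⟨ antidiagonal-+ left right (suc n) ⟩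
    antidiagonal left (suc n) + antidiagonal right (suc n)
      ≡⟨ cong₂ _+_ (+-identityˡ (antidiagonal (λ i → left (suc i)) n))
                   (trans (antidiagonal-last right n) (+-identityʳ (antidiagonal (λ i j → right i (suc j)) n))) ⟩
    antidiagonal (λ i j → binomial i j * h (suc i) j) n + antidiagonal (λ i j → binomial i j * h i (suc j)) n
      ≡⟨ sym (antidiagonal-+ _ _ n) ⟩
    antidiagonal (λ i j → binomial i j * h (suc i) j + binomial i j * h i (suc j)) n
      ≡⟨ antidiagonal-cong n (λ i j _ → sym (*-distribˡ-+ (binomial i j) _ _)) ⟩
    antidiagonal (λ i j → binomial i j * (h (suc i) j + h i (suc j))) n ∎
    where
    open ≡-Reasoning
    left right : ℕ → ℕ → ℤ
    left zero    j = 0ℤ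
    left (suc i) j = binomial i j * h (suc i) j
    right i zero    = 0ℤ
    right i (suc j) = binomial i j * h i (suc j)
    split : ∀ i j → i ℕ.+ j ≡ suc n → binomial i j * h i j ≡ left i j + right i j
    split zero    (suc j) _ = sym (+-identityˡ _)
    split (suc zero)    zero _ = sym (+-identityʳ _)
    split (suc (suc i)) zero _ = sym (+-identityʳ _)
    split (suc i) (suc j) _ = *-distribʳ-+ (h (suc i) (suc j)) (binomial i (suc j)) (binomial (suc i) j)

  -- n! times the coefficient of xⁿ in log(1+x)ᴷ.
  logPower : ℕ → ℕ → ℤ
  logPower K n = fact K * stirling₁ n K

  -- Coefficient form of (1+x) (log(1+x)^(K+1))′ = (K+1) log(1+x)^K; it is the Stirling recurrence
  -- multiplied by (K+1)!.
  logPower-suc : ∀ K n → logPower (suc K) (suc n) ≡ + suc K * logPower K n - + n * logPower (suc K) n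
  logPower-suc K n =
    trans (cong (_* stirling₁ (suc n) (suc K)) (fact-suc K))
    (trans (rearrange (+ suc K) (fact K) (stirling₁ n K) (+ n) (stirling₁ n (suc K)))
           (cong (λ f → + suc K * logPower K n - + n * (f * stirling₁ n (suc K))) (sym (fact-suc K))))
    where
    rearrange : ∀ a b c d e → (a * b) * (c - d * e) ≡ a * (b * c) - d * ((a * b) * e)
    rearrange = solve-∀

  n*logPower₀≡0 : ∀ n → + n * logPower 0 n ≡ 0ℤ
  n*logPower₀≡0 zero    = refl
  n*logPower₀≡0 (suc n) = *-zeroʳ (+ suc n)

  -- The product log(1+x)^(K+1) = log(1+x) · log(1+x)^K of exponential generating functions. By
  -- Leibniz' rule (1+x) times the derivative of the right side is log(1+x)^K + K log(1+x)^K, which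
  -- is the recurrence `logPower-suc` of the left side; induction on n concludes.
  logPower-∗ : ∀ K n → logPower (suc K) n ≡
               antidiagonal (λ i j → binomial i j * (stirling₁ i 1 * logPower K j)) n
  logPower-∗ K zero    = *-zeroʳ (fact (suc K))
  logPower-∗ K (suc n) = sym (begin
    antidiagonal (λ i j → binomial i j * (ℓ i * L j)) (suc n)
      ≡⟨ antidiagonal-pascal (λ i j → ℓ i * L j) n ⟩
    antidiagonal (λ i j → binomial i j * (ℓ (suc i) * L j + ℓ i * L (suc j))) n
      ≡⟨ antidiagonal-cong n pointwise ⟩
    antidiagonal (λ i j → (indicator 0 i * L j + rest K i j) + - (+ n) * (binomial i j * (ℓ i * L j))) n
      ≡⟨ trans (antidiagonal-+ _ _ n) (cong₂ _+_ (antidiagonal-+ _ _ n) refl) ⟩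
    (antidiagonal (λ i j → indicator 0 i * L j) n + antidiagonal (rest K) n)
      + antidiagonal (λ i j → - (+ n) * (binomial i j * (ℓ i * L j))) n
      ≡⟨ cong₂ _+_ (cong₂ _+_ (antidiagonal-indicator 0 n L) (rest-sum K))
                   (trans (antidiagonal-* (- (+ n)) _ n) (cong (- (+ n) *_) (sym (logPower-∗ K n)))) ⟩
    (L n + + K * L n) + - (+ n) * logPower (suc K) n
      ≡⟨ collect (L n) (+ K) (+ n) (logPower (suc K) n) ⟩
    + suc K * L n - + n * logPower (suc K) n
      ≡⟨ sym (logPower-suc K n) ⟩
    logPower (suc K) (suc n) ∎)
    where
    open ≡-Reasoning
    ℓ L : ℕ → ℤ
    ℓ i = stirling₁ i 1
    L = logPower K
    -- The convolution for K · log(1+x) · log(1+x)^(K-1), with K = 0 set apart to avoid a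
    -- predecessor.
    rest : ℕ → ℕ → ℕ → ℤ
    rest zero    i j = 0ℤ
    rest (suc K) i j = + suc K * (binomial i j * (ℓ i * logPower K j))
    rest-sum : ∀ K → antidiagonal (rest K) n ≡ + K * logPower K n
    rest-sum zero    = antidiagonal-0 n
    rest-sum (suc K) = trans (antidiagonal-* (+ suc K) _ n) (cong (+ suc K *_) (sym (logPower-∗ K n)))
    collect : ∀ a k m y → (a + k * a) + - m * y ≡ (1ℤ + k) * a - m * y
    collect = solve-∀
    shift-log : ∀ K i j → binomial i j * (ℓ i * logPower K (suc j)) ≡
                rest K i j - + j * (binomial i j * (ℓ i * logPower K j))
    -- For K = 0 both the shifted entry and j · `logPower 0 j` vanish; inserting the latter gives
    -- the shape common to all K.
    shift-log zero    i j = trans (zeroes (binomial i j) (ℓ i) 0ℤ refl)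
      (trans (cong (λ z → 0ℤ - (binomial i j * ℓ i) * z) (sym (n*logPower₀≡0 j)))
             (move (binomial i j) (ℓ i) (+ j) (logPower 0 j)))
      where
      zeroes : ∀ b l z → z ≡ 0ℤ → b * (l * z) ≡ 0ℤ - (b * l) * 0ℤ
      zeroes b l _ refl = lem b l
        where
        lem : ∀ b l → b * (l * 0ℤ) ≡ 0ℤ - (b * l) * 0ℤ
        lem = solve-∀
      move : ∀ b l j y → 0ℤ - (b * l) * (j * y) ≡ 0ℤ - j * (b * (l * y))
      move = solve-∀
    shift-log (suc K) i j =
      trans (cong (λ z → binomial i j * (ℓ i * z)) (logPower-suc K j))
            (distribute (binomial i j) (ℓ i) (+ suc K) (logPower K j) (+ j) (logPower (suc K) j))
      where
      distribute : ∀ b l k x j y → b * (l * (k * x - j * y)) ≡ k * (b * (l * x)) - j * (b * (l * y))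
      distribute = solve-∀
    binomial-δ : ∀ i j → binomial i j * (stirling₁ i 0 * L j) ≡ indicator 0 i * L j
    binomial-δ zero    j = *-identityˡ _
    binomial-δ (suc i) j = *-zeroʳ (binomial (suc i) j)
    pointwise : ∀ i j → i ℕ.+ j ≡ n →
      binomial i j * (ℓ (suc i) * L j + ℓ i * L (suc j)) ≡
      (indicator 0 i * L j + rest K i j) + - (+ n) * (binomial i j * (ℓ i * L j))
    pointwise i j refl = begin
      binomial i j * ((stirling₁ i 0 - + i * ℓ i) * L j + ℓ i * L (suc j))
        ≡⟨ expand (binomial i j) (stirling₁ i 0) (+ i) (ℓ i) (L j) (L (suc j)) ⟩
      binomial i j * (stirling₁ i 0 * L j) - + i * (binomial i j * (ℓ i * L j))
        + binomial i j * (ℓ i * L (suc j))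
        ≡⟨ cong₂ (λ a b → a - + i * (binomial i j * (ℓ i * L j)) + b) (binomial-δ i j) (shift-log K i j) ⟩
      indicator 0 i * L j - + i * (binomial i j * (ℓ i * L j))
        + (rest K i j - + j * (binomial i j * (ℓ i * L j)))
        ≡⟨ gather (indicator 0 i * L j) (+ i) (+ j) (rest K i j) (binomial i j * (ℓ i * L j)) ⟩
      (indicator 0 i * L j + rest K i j) + - (+ (i ℕ.+ j)) * (binomial i j * (ℓ i * L j)) ∎
      where
      expand : ∀ b d i l x y → b * ((d - i * l) * x + l * y) ≡ b * (d * x) - i * (b * (l * x)) + b * (l * y)
      expand = solve-∀
      gather : ∀ d i j r t → d - i * t + (r - j * t) ≡ (d + r) + - (i + j) * t
      gather = solve-∀

-- Base-p digit sums, valuations and Legendre's formula.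

module Valuations where
  open import Data.Nat.Base
  open import Data.Nat.Properties
  open import Data.Nat.DivMod
  open import Data.Nat.Divisibility
  open import Data.Nat.Tactic.RingSolver using (solve-∀)
  open import Data.Nat.Primality using (Prime; euclidsLemma)
  open import Data.Nat.Induction using (<-rec)
  open import Data.Product using (Σ-syntax; _×_; _,_; proj₁; proj₂)
  open import Data.Sum using (inj₁; inj₂; [_,_]′)
  open import Relation.Nullary using (¬_; yes; no; contradiction)
  open import Relation.Binary.PropositionalEquality

  -- The fuelled loops local to σ, νℕ and unitℕ cannot be named; the following
  -- metavariables are solved by them through the unfolding equations.
  mutual
    σ-loop : ℕ → ℕ → ℕ → ℕ → ℕ
    σ-loop q o f m = _

    σ-unfold : ∀ q m → σ (suc (suc q)) (suc m) ≡
               suc m % suc (suc q) + σ-loop q (suc m) m (suc m / suc (suc q))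
    σ-unfold q m with suc m / suc (suc q) | suc m
    ... | w | o = refl

  mutual
    ν-loop : ℕ → ℕ → ℕ → ℕ → ℕ
    ν-loop q o f m = _

    ν-unfold : ∀ q m → suc (suc q) ∣ suc m →
               νℕ (suc (suc q)) (suc m) ≡ suc (ν-loop q (suc m) m (suc m / suc (suc q)))
    ν-unfold q m d with suc (suc q) ∣? suc m
    ... | no ∤ = contradiction d ∤
    ... | yes _ with suc m / suc (suc q) | suc m
    ...   | w | o = refl

  mutual
    unit-loop : ℕ → ℕ → ℕ → ℕ → ℕ
    unit-loop q o f m = _

    unit-unfold : ∀ q m → suc (suc q) ∣ suc m →
                  unitℕ (suc (suc q)) (suc m) ≡ unit-loop q (suc m) m (suc m / suc (suc q))
    unit-unfold q m d with suc (suc q) ∣? suc m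
    ... | no ∤ = contradiction d ∤
    ... | yes _ with suc m / suc (suc q) | suc m
    ...   | w | o = refl

  module _ (q : ℕ) where
    private
      p = suc (suc q)

    m≤1+f⇒m/p≤f : ∀ {m f} → m ≤ suc f → m / p ≤ f
    m≤1+f⇒m/p≤f {zero}  _   = z≤n
    m≤1+f⇒m/p≤f {suc m} m≤f = s≤s⁻¹ (≤-trans (m/n<m (suc m) p (s≤s (s≤s z≤n))) m≤f)

    σ-loop-0 : ∀ o f → σ-loop q o f 0 ≡ 0
    σ-loop-0 o zero    = refl
    σ-loop-0 o (suc f) = σ-loop-0 o f

    -- Division by p lowers every positive argument, so fuel at least m reaches 0, and from there
    -- nothing is added. This lets `σ-%` replace the fuel of the recursive call by the fuel that σ
    -- itself would supply.
    σ-loop-fuel : ∀ o o′ f f′ m → m ≤ f → m ≤ f′ → σ-loop q o f m ≡ σ-loop q o′ f′ m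
    σ-loop-fuel o o′ zero    f′       .0 z≤n _   = sym (σ-loop-0 o′ f′)
    σ-loop-fuel o o′ (suc f) zero     .0 _   z≤n = σ-loop-0 o (suc f)
    σ-loop-fuel o o′ (suc f) (suc f′) m  h   h′  =
      cong (m % p +_) (σ-loop-fuel o o′ f f′ (m / p) (m≤1+f⇒m/p≤f h) (m≤1+f⇒m/p≤f h′))

    σ-% : ∀ m → σ p m ≡ m % p + σ p (m / p)
    σ-% zero    = refl
    σ-% (suc m) = cong (suc m % p +_) (σ-loop-fuel (suc m) (suc m / p) m (suc m / p) (suc m / p) (m≤1+f⇒m/p≤f ≤-refl) ≤-refl)

    σ-digit : ∀ t k → t < p → σ p (t + k * p) ≡ t + σ p k
    σ-digit t k t<p = trans (σ-% (t + k * p)) (cong₂ (λ a b → a + σ p b)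
      (trans ([m+kn]%n≡m%n t k p) (m<n⇒m%n≡m t<p))
      (trans (+-distrib-/-∣ʳ t (n∣m*n k)) (cong₂ _+_ (m<n⇒m/n≡0 t<p) (m*n/n≡m k p))))

    -- Both loops make the same divisibility tests on the same arguments, so one induction on the
    -- fuel treats the exponent and the cofactor together.
    ν-unit-loop : ∀ o o′ f m → m ≤ f → m ≢ 0 →
      m ≡ unit-loop q o f m * p ^ ν-loop q o′ f m × ¬ (p ∣ unit-loop q o f m)
    ν-unit-loop o o′ zero    zero    _   m≢0 = contradiction refl m≢0
    ν-unit-loop o o′ (suc f) zero    _   m≢0 = contradiction refl m≢0
    ν-unit-loop o o′ (suc f) (suc m) m≤f m≢0 with p ∣? suc m
    ... | no  ∤ = sym (*-identityʳ _) , ∤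
    ... | yes d = step (unit-loop q o f (suc m / p)) (ν-loop q o′ f (suc m / p))
                     (ν-unit-loop o o′ f (suc m / p) (m≤1+f⇒m/p≤f m≤f)
                          (λ e → m≢0 (trans (sym (m/n*n≡m d)) (cong (_* p) e))))
      where
      step : ∀ u v → suc m / p ≡ u * p ^ v × ¬ (p ∣ u) → suc m ≡ u * p ^ suc v × ¬ (p ∣ u)
      step u v (e , ∤) =
        trans (sym (m/n*n≡m d)) (trans (cong (_* p) e)
          (trans (*-assoc u (p ^ v) p) (cong (u *_) (*-comm (p ^ v) p)))) , ∤

    unit*p^ν : ∀ m → m ≢ 0 → m ≡ unitℕ p m * p ^ νℕ p m × ¬ (p ∣ unitℕ p m)
    unit*p^ν m = ν-unit-loop m m m m ≤-refl


  module _ (q : ℕ) where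
    private
      p = suc (suc q)

    -- A relation with the cofactor as witness, so that products are handled without unfolding `νℕ`.
    Valuation : ℕ → ℕ → Set
    Valuation x v = Σ[ u ∈ ℕ ] (x ≡ u * p ^ v × ¬ (p ∣ u))

    valuation-unique : ∀ u v u′ v′ → ¬ (p ∣ u) → ¬ (p ∣ u′) →
                       u * p ^ v ≡ u′ * p ^ v′ → u ≡ u′ × v ≡ v′
    valuation-unique u zero    u′ zero     _  _   e = trans (sym (*-identityʳ u)) (trans e (*-identityʳ u′)) , refl
    valuation-unique u zero    u′ (suc v′) ∤u _   e =
      contradiction (divides (u′ * p ^ v′) (trans (sym (*-identityʳ u)) (trans e (rotate u′ p (p ^ v′))))) ∤u
      where
      rotate : ∀ a b c → a * (b * c) ≡ (a * c) * b
      rotate = solve-∀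
    valuation-unique u (suc v) u′ zero     ∤u ∤u′ e
      with () ← proj₂ (valuation-unique u′ 0 u (suc v) ∤u′ ∤u (sym e))
    valuation-unique u (suc v) u′ (suc v′) ∤u ∤u′ e
      with valuation-unique u v u′ v′ ∤u ∤u′
             (*-cancelʳ-≡ _ _ p (trans (rotate u p (p ^ v)) (trans e (sym (rotate u′ p (p ^ v′))))))
      where
      rotate : ∀ a b c → (a * c) * b ≡ a * (b * c)
      rotate = solve-∀
    ... | e₁ , refl = e₁ , refl

    -- Adding 1 turns the trailing digits p - 1 of m into zeros and raises the next digit by 1. Each
    -- such carry lowers the digit sum by p - 1 and puts one factor p into m + 1.
    σ-suc : ∀ m → Σ[ v ∈ ℕ ] (Valuation (suc m) v × v * suc q + σ p (suc m) ≡ suc (σ p m))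
    σ-suc = <-rec _ step
      where
      step : ∀ m → (∀ {k} → k < m → Σ[ v ∈ ℕ ] (Valuation (suc k) v × v * suc q + σ p (suc k) ≡ suc (σ p k))) →
             Σ[ v ∈ ℕ ] (Valuation (suc m) v × v * suc q + σ p (suc m) ≡ suc (σ p m))
      step m rec = split (m % p) (m / p) (m≡m%n+[m/n]*n m p) (m%n<n m p)
        where
        split : ∀ t k → m ≡ t + k * p → t < p →
                Σ[ v ∈ ℕ ] (Valuation (suc m) v × v * suc q + σ p (suc m) ≡ suc (σ p m))
        split t k refl t<p with m≤n⇒m<n∨m≡n t<p
        ... | inj₁ 1+t<p =
          0 , (suc (t + k * p) , sym (*-identityʳ _) ,
               λ d → >⇒∤ 1+t<p (∣m+n∣m⇒∣n (subst (p ∣_) (+-comm (suc t) (k * p)) d) (n∣m*n k))) ,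
          trans (σ-digit q (suc t) k 1+t<p) (cong suc (sym (σ-digit q t k t<p)))
        -- The last digit is p - 1, so m + 1 = (k + 1) p and the induction hypothesis applies at k.
        ... | inj₂ refl with rec {k} (s≤s (≤-trans (m≤m*n k p) (m≤n+m (k * p) q)))
        ...   | v , (u , e , ∤u) , h =
          suc v , (u , trans (cong (_* p) e) (trans (*-assoc u (p ^ v) p) (cong (u *_) (*-comm (p ^ v) p))) , ∤u) ,
          (begin
            suc q + v * suc q + σ p (suc k * p) ≡⟨ cong (suc q + v * suc q +_) (σ-digit q 0 (suc k) (s≤s z≤n)) ⟩
            suc q + v * suc q + σ p (suc k)     ≡⟨ +-assoc (suc q) (v * suc q) _ ⟩
            suc q + (v * suc q + σ p (suc k))   ≡⟨ cong (suc q +_) h ⟩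
            suc q + suc (σ p k)                 ≡⟨ +-suc (suc q) (σ p k) ⟩
            suc (suc q + σ p k)                 ≡⟨ cong suc (sym (σ-digit q (suc q) k t<p)) ⟩
            suc (σ p (suc q + k * p))           ∎)
          where open ≡-Reasoning

    module _ (p-prime : Prime p) where

      ∤-* : ∀ {a b} → ¬ (p ∣ a) → ¬ (p ∣ b) → ¬ (p ∣ a * b)
      ∤-* {a} {b} ∤a ∤b d = [ ∤a , ∤b ]′ (euclidsLemma a b p-prime d)

      Valuation-* : ∀ {x y v w} → Valuation x v → Valuation y w → Valuation (x * y) (v + w)
      Valuation-* {v = v} {w} (a , refl , ∤a) (b , refl , ∤b) =
        a * b , trans (interchange a (p ^ v) b (p ^ w)) (cong (a * b *_) (sym (^-distribˡ-+-* p v w))) , ∤-* ∤a ∤b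
        where
        interchange : ∀ a x b y → (a * x) * (b * y) ≡ (a * b) * (x * y)
        interchange = solve-∀

      -- Legendre's formula without subtraction; `σ-suc` telescopes over the factors of m!.
      legendre : ∀ m → Σ[ w ∈ ℕ ] (Valuation (m !) w × w * suc q + σ p m ≡ m)
      legendre zero    = 0 , (1 , refl , >⇒∤ (s≤s (s≤s z≤n))) , refl
      legendre (suc m) with σ-suc m | legendre m
      ... | v , val , h | w , val′ , h′ = v + w , Valuation-* {v = v} {w} val val′ , (begin
        (v + w) * suc q + σ p (suc m)         ≡⟨ regroup v w (suc q) (σ p (suc m)) ⟩
        w * suc q + (v * suc q + σ p (suc m)) ≡⟨ cong (w * suc q +_) h ⟩
        w * suc q + suc (σ p m)               ≡⟨ +-suc _ _ ⟩
        suc (w * suc q + σ p m)               ≡⟨ cong suc h′ ⟩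
        suc m                                 ∎)
        where
        open ≡-Reasoning
        regroup : ∀ v w s t → (v + w) * s + t ≡ w * s + (v * s + t)
        regroup = solve-∀

module Congruences where
  open LogarithmPowers
  open Valuations
  open import Data.Nat.Base as ℕ using (ℕ; zero; suc; _!; _∸_; _≤_; _<_; s≤s; z≤n; s≤s⁻¹)
  import Data.Nat.Properties as ℕₚ
  import Data.Nat.DivMod as ℕ/
  open import Data.Nat.Divisibility as ℕ∣ using (divides; >⇒∤)
  open import Data.Nat.Combinatorics using (_C_; k>n⇒nCk≡0; nCk+nC[k+1]≡[n+1]C[k+1]; nCk≡nC[n∸k]; nCn≡1)
  open import Data.Nat.Primality using (Prime; euclidsLemma; prime⇒irreducible)
  open import Data.Nat.Tactic.RingSolver using () renaming (solve-∀ to solveℕ-∀)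
  open import Data.Integer.Base using (ℤ; +_; _+_; _*_; _-_; -_; ∣_∣; sign; _◃_; 0ℤ; 1ℤ; -1ℤ; _^_)
  open import Data.Sign.Base as Sign using ()
  open import Data.Sign.Properties using () renaming (*-identityʳ to sign-*-identityʳ)
  open import Data.Integer.Properties
  open import Data.Integer.Tactic.RingSolver using (solve-∀)
  open import Data.Product using (Σ-syntax; _×_; _,_; proj₁; proj₂)
  open import Data.Sum using (_⊎_; inj₁; inj₂; [_,_]′)
  open import Relation.Nullary using (¬_; yes; no; contradiction)
  open import Relation.Binary.PropositionalEquality

  -- Boundary values of the Stirling numbers.

  stirling₁-< : ∀ {n k} → n < k → stirling₁ n k ≡ 0ℤ
  stirling₁-< {zero}  {suc k} _         = refl
  stirling₁-< {suc n} {suc k} (s≤s n<k) =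
    cong₂ _-_ (stirling₁-< n<k) (trans (cong (+ n *_) (stirling₁-< (ℕₚ.m<n⇒m<1+n n<k))) (*-zeroʳ (+ n)))

  stirling₁-n-n : ∀ n → stirling₁ n n ≡ 1ℤ
  stirling₁-n-n zero    = refl
  stirling₁-n-n (suc n) =
    cong₂ _-_ (stirling₁-n-n n) (trans (cong (+ n *_) (stirling₁-< (ℕₚ.n<1+n n))) (*-zeroʳ (+ n)))

  -- Divided by (a + 1)!, this is the coefficient (-1)^a / (a + 1) of log(1+x).
  stirling₁-1 : ∀ a → stirling₁ (suc a) 1 ≡ -1ℤ ^ a * fact a
  stirling₁-1 zero    = refl
  stirling₁-1 (suc a) = trans (cong (λ s → 0ℤ - + suc a * s) (stirling₁-1 a))
    (trans (rearrange (+ suc a) (-1ℤ ^ a) (fact a)) (cong (-1ℤ ^ suc a *_) (sym (fact-suc a))))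
    where
    rearrange : ∀ n s f → 0ℤ - n * (s * f) ≡ (-1ℤ * s) * (n * f)
    rearrange = solve-∀

  logPower-< : ∀ {n K} → n < K → logPower K n ≡ 0ℤ
  logPower-< {n} {K} n<K = trans (cong (fact K *_) (stirling₁-< n<K)) (*-zeroʳ (fact K))

  logPower-n-n : ∀ n → logPower n n ≡ fact n
  logPower-n-n n = trans (cong (fact n *_) (stirling₁-n-n n)) (*-identityʳ (fact n))

  -- Divisibility in the localisation at p.

  module Local (q : ℕ) (p-prime : Prime (suc (suc q))) where

    p = suc (suc q)

    private
      swap : ∀ u c x → u * (c * x) ≡ c * (u * x)
      swap = solve-∀

    infix 4 _∣ₚ_

    -- Divisibility in ℤ localised at p.
    _∣ₚ_ : ℤ → ℤ → Set
    y ∣ₚ x = Σ[ u ∈ ℕ ] (¬ (p ℕ∣.∣ u) × Σ[ z ∈ ℤ ] (+ u * x ≡ z * y))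

    p∤1 : ¬ (p ℕ∣.∣ 1)
    p∤1 = >⇒∤ (s≤s (s≤s z≤n))

    ∣ₚ-multiple : ∀ {x y} z → x ≡ z * y → y ∣ₚ x
    ∣ₚ-multiple {x} z e = 1 , p∤1 , z , trans (*-identityˡ x) e

    ∣ₚ-0 : ∀ {x y} → x ≡ 0ℤ → y ∣ₚ x
    ∣ₚ-0 {y = y} e = ∣ₚ-multiple 0ℤ (trans e (sym (*-zeroˡ y)))

    ∣ₚ-+ : ∀ {x x′ y} → y ∣ₚ x → y ∣ₚ x′ → y ∣ₚ x + x′
    ∣ₚ-+ {x} {x′} {y} (u , ∤u , z , e) (u′ , ∤u′ , z′ , e′) =
      u ℕ.* u′ , ∤-* q p-prime ∤u ∤u′ , + u′ * z + + u * z′ , (begin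
        + (u ℕ.* u′) * (x + x′)                ≡⟨ cong (_* (x + x′)) (pos-* u u′) ⟩
        (+ u * + u′) * (x + x′)                ≡⟨ distribute (+ u) (+ u′) x x′ ⟩
        + u′ * (+ u * x) + + u * (+ u′ * x′)   ≡⟨ cong₂ (λ a b → + u′ * a + + u * b) e e′ ⟩
        + u′ * (z * y) + + u * (z′ * y)        ≡⟨ factor (+ u) (+ u′) z z′ y ⟩
        (+ u′ * z + + u * z′) * y              ∎)
      where
      open ≡-Reasoning
      distribute : ∀ u v x y → (u * v) * (x + y) ≡ v * (u * x) + u * (v * y)
      distribute = solve-∀
      factor : ∀ u v z w y → v * (z * y) + u * (w * y) ≡ (v * z + u * w) * y
      factor = solve-∀

    ∣ₚ-* : ∀ {x x′ y y′} → y ∣ₚ x → y′ ∣ₚ x′ → y * y′ ∣ₚ x * x′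
    ∣ₚ-* {x} {x′} {y} {y′} (u , ∤u , z , e) (u′ , ∤u′ , z′ , e′) =
      u ℕ.* u′ , ∤-* q p-prime ∤u ∤u′ , z * z′ , (begin
        + (u ℕ.* u′) * (x * x′)      ≡⟨ cong (_* (x * x′)) (pos-* u u′) ⟩
        (+ u * + u′) * (x * x′)      ≡⟨ interchange (+ u) (+ u′) x x′ ⟩
        (+ u * x) * (+ u′ * x′)      ≡⟨ cong₂ _*_ e e′ ⟩
        (z * y) * (z′ * y′)          ≡⟨ interchange z y z′ y′ ⟩
        (z * z′) * (y * y′)          ∎)
      where
      open ≡-Reasoning
      interchange : ∀ a b c d → (a * b) * (c * d) ≡ (a * c) * (b * d)
      interchange = solve-∀

    ∣ₚ-*ˡ : ∀ c {x y} → y ∣ₚ x → c * y ∣ₚ c * x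
    ∣ₚ-*ˡ c h = ∣ₚ-* (∣ₚ-multiple {c} {c} 1ℤ (sym (*-identityˡ c))) h

    ∣ₚ-scale : ∀ c {x y} → y ∣ₚ x → y ∣ₚ c * x
    ∣ₚ-scale c {x} {y} (u , ∤u , z , e) = u , ∤u , c * z ,
      trans (swap (+ u) c x) (trans (cong (c *_) e) (sym (*-assoc c z y)))

    ∣ₚ-cancelˡ : ∀ c {x y} → c ≢ 0ℤ → c * y ∣ₚ c * x → y ∣ₚ x
    ∣ₚ-cancelˡ c {x} {y} c≢0 (u , ∤u , z , e) = u , ∤u , z ,
      *-cancelˡ-≡ c (+ u * x) (z * y) {{ℕ.≢-nonZero (λ e → c≢0 (∣i∣≡0⇒i≡0 e))}}
        (trans (swap c (+ u) x) (trans e (swap z c y)))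

    ∣ₚ-antidiagonal : ∀ {y} F n → (∀ i j → i ℕ.+ j ≡ n → y ∣ₚ F i j) → y ∣ₚ antidiagonal F n
    ∣ₚ-antidiagonal F zero    h = h 0 0 refl
    ∣ₚ-antidiagonal F (suc n) h =
      ∣ₚ-+ (h 0 (suc n) refl)
           (∣ₚ-antidiagonal (λ i j → F (suc i) j) n (λ i j e → h (suc i) j (cong suc e)))

    -- Denominators in the powers of log(1+x).

    p^_ : ℕ → ℤ
    p^ e = + (p ℕ.^ e)

    p^-+ : ∀ a b → p^ (a ℕ.+ b) ≡ p^ a * p^ b
    p^-+ a b = trans (cong +_ (ℕₚ.^-distribˡ-+-* p a b)) (pos-* (p ℕ.^ a) (p ℕ.^ b))

    p^-suc : ∀ e → p^ suc e ≡ + p * p^ e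
    p^-suc e = pos-* p (p ℕ.^ e)

    -- If a + 1 = u p^v with p not dividing u, then p^v ≤ a + 1 < p^(e+1) forces v ≤ e, and u is
    -- invertible in the localisation.
    suc∣ₚp^ : ∀ a e → suc a < p ℕ.^ suc e → + suc a ∣ₚ p^ e
    suc∣ₚp^ a e a<p^1+e with unit*p^ν q (suc a) (λ ())
    ... | e≡ , ∤u = u , ∤u , p^ (e ∸ v) , (begin
      + u * p^ e                       ≡⟨ cong (λ m → + u * p^ m) (sym (ℕₚ.m∸n+n≡m v≤e)) ⟩
      + u * p^ (e ∸ v ℕ.+ v)           ≡⟨ cong (+ u *_) (p^-+ (e ∸ v) v) ⟩
      + u * (p^ (e ∸ v) * p^ v)        ≡⟨ swap (+ u) (p^ (e ∸ v)) (p^ v) ⟩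
      p^ (e ∸ v) * (+ u * p^ v)        ≡⟨ cong (p^ (e ∸ v) *_) (sym (pos-* u (p ℕ.^ v))) ⟩
      p^ (e ∸ v) * + (u ℕ.* p ℕ.^ v)   ≡⟨ cong (λ m → p^ (e ∸ v) * + m) (sym e≡) ⟩
      p^ (e ∸ v) * + suc a             ∎)
      where
      open ≡-Reasoning
      u = unitℕ p (suc a)
      v = νℕ p (suc a)
      u≢0 : u ≢ 0
      u≢0 u≡0 = ∤u (subst (p ℕ∣.∣_) (sym u≡0) (p ℕ∣.∣0))
      v≤e : v ≤ e
      v≤e = s≤s⁻¹ (ℕₚ.≰⇒> (λ e<v → ℕₚ.<⇒≱ a<p^1+e
        (ℕₚ.≤-trans (ℕₚ.^-monoʳ-≤ p e<v)
        (ℕₚ.≤-trans (ℕₚ.m≤n*m (p ℕ.^ v) u {{ℕ.≢-nonZero u≢0}}) (ℕₚ.≤-reflexive (sym e≡))))))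

    -- Bernoulli's inequality for (1 + (p - 1))^e. It bounds the exponent of p in an index i by ⌊(i
    -- - 1)/(p - 1)⌋.
    bernoulli : ∀ e → suc (e ℕ.* suc q) ≤ p ℕ.^ e
    bernoulli zero    = ℕₚ.≤-refl
    bernoulli (suc e) = begin
      suc (suc q ℕ.+ e ℕ.* suc q)        ≡⟨ regroup (suc q) (e ℕ.* suc q) ⟩
      suc (e ℕ.* suc q) ℕ.+ suc q        ≤⟨ ℕₚ.+-mono-≤ (bernoulli e) (ℕₚ.m≤m*n (suc q) (p ℕ.^ e) {{ℕₚ.m^n≢0 p e}}) ⟩
      p ℕ.^ e ℕ.+ suc q ℕ.* p ℕ.^ e      ∎
      where
      open ℕₚ.≤-Reasoning
      regroup : ∀ s t → suc (s ℕ.+ t) ≡ suc t ℕ.+ s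
      regroup = solveℕ-∀

    -- Strict from exponent 2 on; the equalities at exponents 0 and 1 are what singles out i = 1 and
    -- i = p.
    bernoulli-< : ∀ e → suc (suc (suc e) ℕ.* suc q) < p ℕ.^ suc (suc e)
    bernoulli-< e = begin-strict
      suc (suc q ℕ.+ suc e ℕ.* suc q)          ≡⟨ regroup (suc q) (suc e ℕ.* suc q) ⟩
      suc (suc e ℕ.* suc q) ℕ.+ suc q          <⟨ ℕₚ.+-mono-≤-< (bernoulli (suc e))
                                                    (ℕₚ.m<m*n (suc q) (p ℕ.^ suc e)
                                                      (ℕₚ.≤-trans (s≤s (s≤s z≤n)) (bernoulli (suc e)))) ⟩
      p ℕ.^ suc e ℕ.+ suc q ℕ.* p ℕ.^ suc e    ∎
      where
      open ℕₚ.≤-Reasoning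
      regroup : ∀ s t → suc (s ℕ.+ t) ≡ suc t ℕ.+ s
      regroup = solveℕ-∀

    -- By `stirling₁-1` the coefficient of x^(a+1) has denominator a + 1. The factor c is 1 for
    -- integrality and p for vanishing modulo p.
    fact∣ₚlog : ∀ c a P → c * + suc a ∣ₚ P → c * fact (suc a) ∣ₚ P * stirling₁ (suc a) 1
    fact∣ₚlog c a P h = subst₂ _∣ₚ_
      (trans (*-assoc c (+ suc a) (fact a)) (cong (c *_) (sym (fact-suc a))))
      (cong (P *_) (sym (stirling₁-1 a)))
      (∣ₚ-* h (∣ₚ-multiple (-1ℤ ^ a) refl))

    convolution-term : ∀ c i j P Q l x → c * fact i ∣ₚ P * l → fact j ∣ₚ Q * x →
      c * fact (i ℕ.+ j) ∣ₚ (P * Q) * (binomial i j * (l * x))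
    convolution-term c i j P Q l x h h′ = subst₂ _∣ₚ_
      (trans (pull c (binomial i j) (fact i) (fact j)) (cong (c *_) (binomial-fact i j)))
      (regroup P Q (binomial i j) l x)
      (∣ₚ-*ˡ (binomial i j) (∣ₚ-* h h′))
      where
      pull : ∀ c b f g → b * ((c * f) * g) ≡ c * (b * (f * g))
      pull = solve-∀
      regroup : ∀ P Q b l x → b * ((P * l) * (Q * x)) ≡ (P * Q) * (b * (l * x))
      regroup = solve-∀

    -- The hypothesis says e ≥ ⌊(n - K)/(p - 1)⌋ without subtraction. A factor of index i costs at
    -- most ⌊(i - 1)/(p - 1)⌋ powers of p, and a sum of floors is at most the floor of the sum;
    -- induction on K.
    fact∣ₚlogPower : ∀ K e n → n < K ℕ.+ suc e ℕ.* suc q → fact n ∣ₚ p^ e * logPower K n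
    fact∣ₚlogPower zero e zero _ = ∣ₚ-multiple (p^ e * logPower 0 0) (sym (*-identityʳ _))
    fact∣ₚlogPower zero e (suc n) _ = ∣ₚ-0 (*-zeroʳ (p^ e))
    fact∣ₚlogPower (suc K) e n n< =
      subst (fact n ∣ₚ_) (trans (antidiagonal-* (p^ e) _ n) (cong (p^ e *_) (sym (logPower-∗ K n))))
        (∣ₚ-antidiagonal _ n term)
      where
      term : ∀ i j → i ℕ.+ j ≡ n → fact n ∣ₚ p^ e * (binomial i j * (stirling₁ i 1 * logPower K j))
      term zero j refl = ∣ₚ-0 (zeroes (p^ e) (binomial 0 j) (logPower K j))
        where
        zeroes : ∀ a b c → a * (b * (0ℤ * c)) ≡ 0ℤ
        zeroes = solve-∀
      term (suc a) j refl with ℕₚ.<-≤-connex j K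
      ... | inj₁ j<K = ∣ₚ-0 (trans (cong (λ x → p^ e * (binomial (suc a) j * (stirling₁ (suc a) 1 * x))) (logPower-< j<K))
                                   (zeroes (p^ e) (binomial (suc a) j) (stirling₁ (suc a) 1)))
        where
        zeroes : ∀ a b c → a * (b * (c * 0ℤ)) ≡ 0ℤ
        zeroes = solve-∀
      ... | inj₂ K≤j = subst₂ _∣ₚ_ (*-identityˡ (fact (suc a ℕ.+ j)))
          (cong (_* (binomial (suc a) j * (stirling₁ (suc a) 1 * logPower K j)))
                (trans (sym (p^-+ e₁ e₂)) (cong p^_ (ℕₚ.m∸n+n≡m e₂≤e))))
          (convolution-term 1ℤ (suc a) j (p^ e₁) (p^ e₂) (stirling₁ (suc a) 1) (logPower K j)
            (fact∣ₚlog 1ℤ a (p^ e₁) (subst (_∣ₚ p^ e₁) (sym (*-identityˡ (+ suc a)))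
                                           (suc∣ₚp^ a e₁ (ℕₚ.<-≤-trans (s≤s a<) (bernoulli (suc e₁))))))
            (fact∣ₚlogPower K e₂ j j<))
        where
        s = suc q
        b = j ∸ K
        j≡ : j ≡ K ℕ.+ b
        j≡ = sym (ℕₚ.m+[n∸m]≡n K≤j)
        a+b< : a ℕ.+ b < suc e ℕ.* s
        a+b< = ℕₚ.+-cancelˡ-< (suc K) (a ℕ.+ b) (suc e ℕ.* s)
          (subst (_< suc K ℕ.+ suc e ℕ.* s) (trans (cong (λ m → suc a ℕ.+ m) j≡) (regroup a K b)) n<)
          where
          regroup : ∀ a K b → suc a ℕ.+ (K ℕ.+ b) ≡ suc K ℕ.+ (a ℕ.+ b)
          regroup = solveℕ-∀
        -- The share of e that the coefficient of log(1+x)^K at j requires; the remainder `e₁` goes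
        -- to the logarithm at i = a + 1.
        e₂ = b ℕ./ s
        e₁ = e ∸ e₂
        e₂≤e : e₂ ≤ e
        e₂≤e = s≤s⁻¹ (ℕ/.m<n*o⇒m/o<n (ℕₚ.≤-<-trans (ℕₚ.m≤n+m b a) a+b<))
        j< : j < K ℕ.+ suc e₂ ℕ.* s
        j< = subst (_< K ℕ.+ suc e₂ ℕ.* s) (sym j≡) (ℕₚ.+-monoʳ-< K
               (subst (_< suc e₂ ℕ.* s) (sym (ℕ/.m≡m%n+[m/n]*n b s)) (ℕₚ.+-monoˡ-< (e₂ ℕ.* s) (ℕ/.m%n<n b s))))
        a< : a < suc e₁ ℕ.* s
        a< = ℕₚ.+-cancelʳ-< (e₂ ℕ.* s) a (suc e₁ ℕ.* s) (ℕₚ.≤-<-trans (ℕₚ.+-monoʳ-≤ a (ℕ/.m/n*n≤m b s))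
               (subst (a ℕ.+ b <_) (trans (cong (λ m → suc m ℕ.* s) (sym (ℕₚ.m∸n+n≡m e₂≤e)))
                                          (ℕₚ.*-distribʳ-+ s (suc e₁) e₂)) a+b<))

    -- Residues modulo p of the scaled powers of log(1+x).

    p∣-1^[p-1]-1 : Σ[ z ∈ ℤ ] (-1ℤ ^ suc q - 1ℤ ≡ z * + p)
    p∣-1^[p-1]-1 with parity (suc q)
      where
      parity : ∀ n → -1ℤ ^ n ≡ 1ℤ ⊎ (-1ℤ ^ n ≡ -1ℤ × 2 ℕ∣.∣ suc n)
      parity zero          = inj₁ refl
      parity (suc zero)    = inj₂ (refl , ℕ∣.∣-refl)
      parity (suc (suc n)) with parity n
      ... | inj₁ e       = inj₁ (cong (λ x → -1ℤ * (-1ℤ * x)) e)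
      ... | inj₂ (e , d) = inj₂ (cong (λ x → -1ℤ * (-1ℤ * x)) e , ℕ∣.∣m∣n⇒∣m+n ℕ∣.∣-refl d)
    ... | inj₁ e       = 0ℤ , cong (_- 1ℤ) e
    -- The sign -1 makes 2 a divisor of p, so p = 2, where -1 - 1 = (-1) · p.
    ... | inj₂ (e , d) with prime⇒irreducible p-prime d
    ...   | inj₂ refl = -1ℤ , refl

    -- One factor is known exactly as γ i!, the other modulo p j!. Replacing γ by 1 changes the
    -- product by a multiple of p, since γQx - gc = γ(Qx - gc) + (γ - 1)gc with g = j!.
    convolution-residue : ∀ i j P Q l x γ c → P * l ≡ γ * fact i → Σ[ z ∈ ℤ ] (γ - 1ℤ ≡ z * + p) →
      + p * fact j ∣ₚ Q * x - fact j * c →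
      + p * fact (i ℕ.+ j) ∣ₚ (P * Q) * (binomial i j * (l * x)) - fact (i ℕ.+ j) * c
    convolution-residue i j P Q l x γ c e (z , γ≡1) h = subst₂ _∣ₚ_
      (trans (pull (+ p) (binomial i j) (fact i) (fact j)) (cong (+ p *_) (binomial-fact i j)))
      (begin
        b * (f * (γ * (Q * x - g * c) + (γ - 1ℤ) * (g * c)))  ≡⟨ expand b f γ (Q * x) g c ⟩
        b * ((γ * f) * (Q * x)) - (b * (f * g)) * c           ≡⟨ cong₂ (λ y w → b * (y * (Q * x)) - w * c) (sym e) (binomial-fact i j) ⟩
        b * ((P * l) * (Q * x)) - fact (i ℕ.+ j) * c          ≡⟨ cong (_- fact (i ℕ.+ j) * c) (regroup P Q b l x) ⟩
        (P * Q) * (b * (l * x)) - fact (i ℕ.+ j) * c          ∎)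
      (∣ₚ-*ˡ b (∣ₚ-*ˡ f (∣ₚ-+ (∣ₚ-scale γ h)
        (∣ₚ-multiple (z * c) (trans (cong (_* (g * c)) γ≡1) (rotate z (+ p) g c))))))
      where
      open ≡-Reasoning
      b = binomial i j
      f = fact i
      g = fact j
      pull : ∀ c b f g → b * (f * (c * g)) ≡ c * (b * (f * g))
      pull = solve-∀
      regroup : ∀ P Q b l x → b * ((P * l) * (Q * x)) ≡ (P * Q) * (b * (l * x))
      regroup = solve-∀
      expand : ∀ b f γ y g c → b * (f * (γ * (y - g * c) + (γ - 1ℤ) * (g * c))) ≡
                               b * ((γ * f) * y) - (b * (f * g)) * c
      expand = solve-∀
      rotate : ∀ z p g c → (z * p) * (g * c) ≡ (z * c) * (p * g)
      rotate = solve-∀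

    -- Away from i = 1 and i = p a factor p is left over: e = 0 leaves only a = 0, for e = 1 the
    -- exclusion sharpens a + 1 ≤ p to a + 1 < p, and for e ≥ 2 Bernoulli's inequality is strict.
    p*suc∣ₚp^ : ∀ a e → a ≤ e ℕ.* suc q → a ≢ 0 → a ≢ suc q → + p * + suc a ∣ₚ p^ e
    p*suc∣ₚp^ a zero    a≤ a≢0 _    = contradiction (ℕₚ.n≤0⇒n≡0 a≤) a≢0
    p*suc∣ₚp^ a (suc e) a≤ _   a≢s =
      subst (+ p * + suc a ∣ₚ_) (sym (p^-suc e)) (∣ₚ-*ˡ (+ p) (suc∣ₚp^ a e (1+a< e a≤)))
      where
      1+a< : ∀ e → a ≤ suc e ℕ.* suc q → suc a < p ℕ.^ suc e
      1+a< zero    a≤ = subst (suc a <_) (sym (ℕₚ.*-identityʳ p))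
        (s≤s (ℕₚ.≤∧≢⇒< (subst (a ≤_) (ℕₚ.+-identityʳ (suc q)) a≤) a≢s))
      1+a< (suc e) a≤ = ℕₚ.≤-<-trans (s≤s a≤) (bernoulli-< e)

    -- Induction on K through log(1+x) · log(1+x)^K. Modulo p only i = 1 and i = p survive; for
    -- exponent r + 1 they contribute C(K, r+1) and C(K, r), which Pascal's rule adds up.
    logPower-residue : ∀ K r n → n ≡ K ℕ.+ r ℕ.* suc q →
                       + p * fact n ∣ₚ p^ r * logPower K n - fact n * + (K C r)
    logPower-residue K zero n e rewrite trans e (ℕₚ.+-identityʳ K) =
      ∣ₚ-0 (trans (cong₂ (λ x c → 1ℤ * x - fact K * + c) (logPower-n-n K) (trans (nCk≡nC[n∸k] {0} {K} z≤n) (nCn≡1 K))) (cancel (fact K)))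
      where
      cancel : ∀ f → 1ℤ * f - f * 1ℤ ≡ 0ℤ
      cancel = solve-∀
    logPower-residue zero (suc r) n refl =
      ∣ₚ-0 (trans (cong (λ c → p^ suc r * 0ℤ - fact n * + c) (k>n⇒nCk≡0 {0} {suc r} (s≤s z≤n)))
                  (zeroes (p^ suc r) (fact n)))
      where
      zeroes : ∀ a b → a * 0ℤ - b * 0ℤ ≡ 0ℤ
      zeroes = solve-∀
    logPower-residue (suc K) (suc r) n refl =
      subst (+ p * fact n ∣ₚ_) total (∣ₚ-antidiagonal (λ i j → F i j + - fact n * G i j) n term)
      where
      s = suc q
      c₁ c₂ : ℤ
      c₁ = + (K C suc r)
      c₂ = + (K C r)
      -- `G` spreads C(K+1, r+1) over the antidiagonal as masses at i = 1 and i = p, so that the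
      -- congruence can be checked term by term.
      F G : ℕ → ℕ → ℤ
      F i j = p^ suc r * (binomial i j * (stirling₁ i 1 * logPower K j))
      G i j = indicator 1 i * c₁ + indicator p i * c₂

      total : antidiagonal (λ i j → F i j + - fact n * G i j) n ≡
              p^ suc r * logPower (suc K) n - fact n * + (suc K C suc r)
      total = begin
        antidiagonal (λ i j → F i j + - fact n * G i j) n
          ≡⟨ antidiagonal-+ F (λ i j → - fact n * G i j) n ⟩
        antidiagonal F n + antidiagonal (λ i j → - fact n * G i j) n
          ≡⟨ cong₂ _+_ (trans (antidiagonal-* (p^ suc r) (λ i j → binomial i j * (stirling₁ i 1 * logPower K j)) n) (cong (p^ suc r *_) (sym (logPower-∗ K n))))
                       (antidiagonal-* (- fact n) G n) ⟩
        p^ suc r * logPower (suc K) n + - fact n * antidiagonal G n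
          ≡⟨ cong (λ x → p^ suc r * logPower (suc K) n + - fact n * x)
                  (trans (antidiagonal-+ (λ i j → indicator 1 i * c₁) (λ i j → indicator p i * c₂) n)
                         (cong₂ _+_ (antidiagonal-indicator 1 (K ℕ.+ suc r ℕ.* s) (λ _ → c₁))
                                    (trans (cong (antidiagonal (λ i j → indicator p i * c₂)) (n≡ K s (r ℕ.* s)))
                                           (antidiagonal-indicator p (K ℕ.+ r ℕ.* s) (λ _ → c₂))))) ⟩
        p^ suc r * logPower (suc K) n + - fact n * (c₁ + c₂)
          ≡⟨ cong (λ x → p^ suc r * logPower (suc K) n + x)
                   (trans (sym (neg-distribˡ-* (fact n) (c₁ + c₂)))
                          (cong (λ x → - (fact n * x)) (trans (+-comm c₁ c₂) (cong +_ (nCk+nC[k+1]≡[n+1]C[k+1] K r))))) ⟩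
        p^ suc r * logPower (suc K) n - fact n * + (suc K C suc r) ∎
        where
        open ≡-Reasoning
        n≡ : ∀ K s t → suc K ℕ.+ (s ℕ.+ t) ≡ suc s ℕ.+ (K ℕ.+ t)
        n≡ = solveℕ-∀

      term : ∀ i j → i ℕ.+ j ≡ n → + p * fact n ∣ₚ F i j + - fact n * G i j
      term zero j _ = ∣ₚ-0 (zeroes (p^ suc r) (binomial 0 j) (logPower K j) (fact n) c₁ c₂)
        where
        zeroes : ∀ a b c f x y → a * (b * (0ℤ * c)) + - f * (0ℤ * x + 0ℤ * y) ≡ 0ℤ
        zeroes = solve-∀
      term (suc a) j e with a ℕₚ.≟ 0 | a ℕₚ.≟ s
      -- At i = 1 the logarithm has coefficient 1, so all of p^(r+1) goes to log(1+x)^K.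
      ... | yes refl | _ = subst₂ _∣ₚ_ (cong (λ m → + p * fact m) e)
        (trans (cong (λ m → (1ℤ * p^ suc r) * (binomial 1 j * (1ℤ * logPower K j)) - fact m * c₁) e)
               (tidy (p^ suc r) (binomial 1 j * (1ℤ * logPower K j)) (fact n) c₁ c₂))
        (convolution-residue 1 j 1ℤ (p^ suc r) 1ℤ (logPower K j) 1ℤ c₁ refl (0ℤ , refl)
          (logPower-residue K (suc r) j (ℕₚ.suc-injective e)))
        where
        tidy : ∀ P b f c d → (1ℤ * P) * b - f * c ≡ P * b + - f * (1ℤ * c + 0ℤ * d)
        tidy = solve-∀
      -- At i = p one factor p cancels the denominator and leaves (-1)^(p-1), which is 1 modulo p;
      -- p^r remains for log(1+x)^K.
      ... | no _ | yes refl = subst₂ _∣ₚ_ (cong (λ m → + p * fact m) e)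
        (trans (cong₂ (λ m P → P * (binomial p j * (stirling₁ p 1 * logPower K j)) - fact m * c₂) e (sym (p^-suc r)))
        (trans (tidy (p^ suc r) (binomial p j * (stirling₁ p 1 * logPower K j)) (fact n) c₁ c₂)
               (cong (λ x → p^ suc r * (binomial p j * (stirling₁ p 1 * logPower K j)) + - fact n * (0ℤ * c₁ + x * c₂))
                     (sym (indicator-refl p)))))
        (convolution-residue p j (+ p) (p^ r) (stirling₁ p 1) (logPower K j) (-1ℤ ^ s) c₂
          (trans (cong (+ p *_) (stirling₁-1 s))
                 (trans (swap (+ p) (-1ℤ ^ s) (fact s)) (cong (-1ℤ ^ s *_) (sym (fact-suc s)))))
          p∣-1^[p-1]-1
          (logPower-residue K r j (ℕₚ.+-cancelˡ-≡ p j _ (trans e (n≡ K s (r ℕ.* s))))))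
        where
        n≡ : ∀ K s t → suc K ℕ.+ (s ℕ.+ t) ≡ suc s ℕ.+ (K ℕ.+ t)
        n≡ = solveℕ-∀
        tidy : ∀ P b f c d → P * b - f * d ≡ P * b + - f * (0ℤ * c + 1ℤ * d)
        tidy = solve-∀
      ... | no a≢0 | no a≢s =
        subst (+ p * fact n ∣ₚ_)
          (trans (tidy (F (suc a) j) (fact n) c₁ c₂)
                 (cong₂ (λ x y → F (suc a) j + - fact n * (x * c₁ + y * c₂))
                        (sym (indicator-≢ 0 a a≢0)) (sym (indicator-≢ s a a≢s))))
          (off-peak (ℕₚ.<-≤-connex j K))
        where
        tidy : ∀ x f c d → x ≡ x + - f * (0ℤ * c + 0ℤ * d)
        tidy = solve-∀
        off-peak : j < K ⊎ K ≤ j → + p * fact n ∣ₚ F (suc a) j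
        off-peak (inj₁ j<K) =
          ∣ₚ-0 (trans (cong (λ x → p^ suc r * (binomial (suc a) j * (stirling₁ (suc a) 1 * x))) (logPower-< j<K))
                      (zeroes (p^ suc r) (binomial (suc a) j) (stirling₁ (suc a) 1)))
          where
          zeroes : ∀ a b c → a * (b * (c * 0ℤ)) ≡ 0ℤ
          zeroes = solve-∀
        off-peak (inj₂ K≤j) = subst₂ _∣ₚ_ (cong (λ m → + p * fact m) e)
          (cong (_* (binomial (suc a) j * (stirling₁ (suc a) 1 * logPower K j)))
                (trans (sym (p^-+ e₁ e₂)) (cong p^_ (ℕₚ.m∸n+n≡m e₂≤))))
          (convolution-term (+ p) (suc a) j (p^ e₁) (p^ e₂) (stirling₁ (suc a) 1) (logPower K j)
            (fact∣ₚlog (+ p) a (p^ e₁) (p*suc∣ₚp^ a e₁ a≤ a≢0 a≢s))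
            (fact∣ₚlogPower K e₂ j j<))
          where
          b = j ∸ K
          j≡ : j ≡ K ℕ.+ b
          j≡ = sym (ℕₚ.m+[n∸m]≡n K≤j)
          a+b≡ : a ℕ.+ b ≡ suc r ℕ.* s
          a+b≡ = ℕₚ.+-cancelˡ-≡ (suc K) (a ℕ.+ b) (suc r ℕ.* s)
            (trans (regroup a K b) (trans (cong (λ m → suc a ℕ.+ m) (sym j≡)) e))
            where
            regroup : ∀ a K b → suc K ℕ.+ (a ℕ.+ b) ≡ suc a ℕ.+ (K ℕ.+ b)
            regroup = solveℕ-∀
          e₂ = b ℕ./ s
          e₁ = suc r ∸ e₂
          e₂≤ : e₂ ≤ suc r
          e₂≤ = subst (e₂ ≤_) (ℕ/.m*n/n≡m (suc r) s)
                  (ℕ/./-monoˡ-≤ s (subst (b ≤_) a+b≡ (ℕₚ.m≤n+m b a)))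
          j< : j < K ℕ.+ suc e₂ ℕ.* s
          j< = subst (_< K ℕ.+ suc e₂ ℕ.* s) (sym j≡) (ℕₚ.+-monoʳ-< K
                 (subst (_< suc e₂ ℕ.* s) (sym (ℕ/.m≡m%n+[m/n]*n b s)) (ℕₚ.+-monoˡ-< (e₂ ℕ.* s) (ℕ/.m%n<n b s))))
          -- Since a + b equals (r + 1)(p - 1) exactly, rounding b down to `e₂` multiples of p - 1
          -- leaves at least a for the share `e₁`.
          a≤ : a ≤ e₁ ℕ.* s
          a≤ = ℕₚ.+-cancelʳ-≤ (e₂ ℕ.* s) a (e₁ ℕ.* s) (ℕₚ.≤-trans (ℕₚ.+-monoʳ-≤ a (ℕ/.m/n*n≤m b s))
                 (ℕₚ.≤-reflexive (trans a+b≡ (trans (cong (ℕ._* s) (sym (ℕₚ.m∸n+n≡m e₂≤)))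
                                                    (ℕₚ.*-distribʳ-+ s e₁ e₂)))))

    -- From powers of the logarithm to Stirling numbers.

    stirling₁-split : ∀ P N K → P * (fact K * stirling₁ (suc N) (suc K)) ≡
                      P * logPower K N + - (+ N * (P * (fact K * stirling₁ N (suc K))))
    stirling₁-split P N K = distribute P (fact K) (stirling₁ N K) (+ N) (stirling₁ N (suc K))
      where
      distribute : ∀ P f a n b → P * (f * (a - n * b)) ≡ P * (f * a) + - (n * (P * (f * b)))
      distribute = solve-∀

    ∣ₚ-neg : ∀ {x y} → y ∣ₚ x → y ∣ₚ - x
    ∣ₚ-neg {x} {y} h = subst (y ∣ₚ_) (-1*i≡-i x) (∣ₚ-scale -1ℤ h)

    -- The recurrence is iterated downwards in N with K fixed: its factor N supplies exactly what N!
    -- has beyond (N - 1)!, and the bound on N persists.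
    fact∣ₚstirling₁ : ∀ K e N → N < K ℕ.+ suc e ℕ.* suc q →
                      fact N ∣ₚ p^ e * (fact K * stirling₁ (suc N) (suc K))
    fact∣ₚstirling₁ K e N N< = subst (fact N ∣ₚ_) (sym (stirling₁-split (p^ e) N K))
      (∣ₚ-+ (fact∣ₚlogPower K e N N<) (∣ₚ-neg (tail N N<)))
      where
      tail : ∀ N → N < K ℕ.+ suc e ℕ.* suc q →
             fact N ∣ₚ + N * (p^ e * (fact K * stirling₁ N (suc K)))
      tail zero    _  = ∣ₚ-0 (*-zeroˡ (p^ e * (fact K * 0ℤ)))
      tail (suc N) N< = subst (_∣ₚ + suc N * (p^ e * (fact K * stirling₁ (suc N) (suc K)))) (sym (fact-suc N))
        (∣ₚ-*ˡ (+ suc N) (fact∣ₚstirling₁ K e N (ℕₚ.<⇒≤ N<)))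

    -- Only the term s(N, K) counts modulo p. In the other one the index has dropped below K + r(p -
    -- 1), so p^(r-1) already clears its denominators and a factor p is left over.
    stirling₁-residue : ∀ K r N → N ≡ K ℕ.+ r ℕ.* suc q →
      + p * fact N ∣ₚ p^ r * (fact K * stirling₁ (suc N) (suc K)) - fact N * + (K C r)
    stirling₁-residue K r N e = subst (+ p * fact N ∣ₚ_)
      (trans (regroup (p^ r * logPower K N) (fact N * + (K C r)) (+ N * (p^ r * (fact K * stirling₁ N (suc K)))))
             (cong (_- fact N * + (K C r)) (sym (stirling₁-split (p^ r) N K))))
      (∣ₚ-+ (logPower-residue K r N e) (∣ₚ-neg (tail r N e)))
      where
      regroup : ∀ x y z → (x - y) + - z ≡ (x + - z) - y
      regroup = solve-∀
      tail : ∀ r N → N ≡ K ℕ.+ r ℕ.* suc q →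
             + p * fact N ∣ₚ + N * (p^ r * (fact K * stirling₁ N (suc K)))
      tail r       zero    _ = ∣ₚ-0 (*-zeroˡ (p^ r * (fact K * 0ℤ)))
      -- For r = 0 the tail contains s(K, K + 1) = 0.
      tail zero    (suc N) e = ∣ₚ-0 (trans (cong (λ x → + suc N * (1ℤ * (fact K * x)))
                                                 (stirling₁-< (s≤s (ℕₚ.≤-reflexive (trans e (ℕₚ.+-identityʳ K))))))
                                           (zeroes (+ suc N) (fact K)))
        where
        zeroes : ∀ n f → n * (1ℤ * (f * 0ℤ)) ≡ 0ℤ
        zeroes = solve-∀
      tail (suc r) (suc N) e = subst₂ _∣ₚ_ (cong (+ p *_) (sym (fact-suc N)))
        (trans (rotate (+ p) (+ suc N) (p^ r) (fact K * stirling₁ (suc N) (suc K)))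
               (cong (λ P → + suc N * (P * (fact K * stirling₁ (suc N) (suc K)))) (sym (p^-suc r))))
        (∣ₚ-*ˡ (+ p) (∣ₚ-*ˡ (+ suc N) (fact∣ₚstirling₁ K r N (ℕₚ.≤-reflexive e))))
        where
        rotate : ∀ p n P x → p * (n * (P * x)) ≡ n * ((p * P) * x)
        rotate = solve-∀

    -- Unit parts and the minimum zero case.

    ε*p^ν : ∀ x → x ≢ 0ℤ → x ≡ ε p x * p^ (ν p x)
    ε*p^ν x x≢0 = begin
      x                                                          ≡⟨ sym (signᵢ◃∣i∣≡i x) ⟩
      sign x ◃ ∣ x ∣                                             ≡⟨ cong (sign x ◃_) (proj₁ (unit*p^ν q ∣ x ∣ (λ e → x≢0 (∣i∣≡0⇒i≡0 e)))) ⟩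
      sign x ◃ unitℕ p ∣ x ∣ ℕ.* p ℕ.^ ν p x                     ≡⟨ cong (_◃ unitℕ p ∣ x ∣ ℕ.* p ℕ.^ ν p x) (sym (sign-*-identityʳ (sign x))) ⟩
      (sign x Sign.* Sign.+) ◃ unitℕ p ∣ x ∣ ℕ.* p ℕ.^ ν p x     ≡⟨ ◃-distrib-* (sign x) Sign.+ (unitℕ p ∣ x ∣) (p ℕ.^ ν p x) ⟩
      ε p x * (Sign.+ ◃ p ℕ.^ ν p x)                             ≡⟨ cong (ε p x *_) (+◃n≡+n (p ℕ.^ ν p x)) ⟩
      ε p x * p^ (ν p x)                                         ∎
      where open ≡-Reasoning

    -- The return from the localisation: p does not divide the cofactor u, so Euclid's lemma moves
    -- the factor p onto x.
    ∣ₚ⇒∣ : ∀ {x y} → + p * y ∣ₚ x → p ℕ∣.∣ ∣ x ∣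
    ∣ₚ⇒∣ {x} {y} (u , ∤u , z , e) =
      [ (λ d → contradiction d ∤u) , (λ d → d) ]′
        (euclidsLemma u ∣ x ∣ p-prime (divides ∣ z * y ∣ (begin
          u ℕ.* ∣ x ∣        ≡⟨ sym (abs-* (+ u) x) ⟩
          ∣ + u * x ∣        ≡⟨ cong ∣_∣ (trans e (rotate z (+ p) y)) ⟩
          ∣ (z * y) * + p ∣  ≡⟨ abs-* (z * y) (+ p) ⟩
          ∣ z * y ∣ ℕ.* p    ∎)))
      where
      open ≡-Reasoning
      rotate : ∀ z p y → z * (p * y) ≡ (z * y) * p
      rotate = solve-∀

    -- Legendre's formula gives (p - 1) ν(F) = (N - K) + (σ(K) - σ(N)), where the two differences
    -- are r(p - 1) and v(p - 1).
    ν-factorial-quotient : ∀ {N K r v F} → F ≢ 0 → F ℕ.* K ! ≡ N ! → N ≡ K ℕ.+ r ℕ.* suc q →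
                           v ℕ.* suc q ℕ.+ σ p N ≡ σ p K → νℕ p F ≡ v ℕ.+ r
    ν-factorial-quotient {N} {K} {r} {v} {F} F≢0 F*K!≡N! N≡ min
      with legendre q p-prime N | legendre q p-prime K
    ... | wN , (uN , eN , ∤N) , hN | wK , val-K@(uK , eK , ∤K) , hK =
      ℕₚ.*-cancelʳ-≡ w (v ℕ.+ r) s (ℕₚ.+-cancelʳ-≡ (wK ℕ.* s ℕ.+ σ p N) (w ℕ.* s) ((v ℕ.+ r) ℕ.* s) (begin
        w ℕ.* s ℕ.+ (wK ℕ.* s ℕ.+ σ p N)             ≡⟨ regroup w wK s (σ p N) ⟩
        (w ℕ.+ wK) ℕ.* s ℕ.+ σ p N                   ≡⟨ cong (λ x → x ℕ.* s ℕ.+ σ p N) w+wK≡wN ⟩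
        wN ℕ.* s ℕ.+ σ p N                           ≡⟨ trans hN N≡ ⟩
        K ℕ.+ r ℕ.* s                                ≡⟨ cong (ℕ._+ r ℕ.* s) (sym hK) ⟩
        wK ℕ.* s ℕ.+ σ p K ℕ.+ r ℕ.* s               ≡⟨ cong (λ x → wK ℕ.* s ℕ.+ x ℕ.+ r ℕ.* s) (sym min) ⟩
        wK ℕ.* s ℕ.+ (v ℕ.* s ℕ.+ σ p N) ℕ.+ r ℕ.* s ≡⟨ collect wK v r s (σ p N) ⟩
        (v ℕ.+ r) ℕ.* s ℕ.+ (wK ℕ.* s ℕ.+ σ p N)     ∎))
      where
      open ≡-Reasoning
      s = suc q
      w = νℕ p F
      w+wK≡wN : w ℕ.+ wK ≡ wN
      w+wK≡wN with Valuation-* q p-prime {v = w} {wK} (unitℕ p F , unit*p^ν q F F≢0) val-K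
      ... | u , e , ∤u = proj₂ (valuation-unique q u (w ℕ.+ wK) uN wN ∤u ∤N (trans (sym e) (trans F*K!≡N! eN)))
      regroup : ∀ w k s t → w ℕ.* s ℕ.+ (k ℕ.* s ℕ.+ t) ≡ (w ℕ.+ k) ℕ.* s ℕ.+ t
      regroup = solveℕ-∀
      collect : ∀ k v r s t → k ℕ.* s ℕ.+ (v ℕ.* s ℕ.+ t) ℕ.+ r ℕ.* s ≡ (v ℕ.+ r) ℕ.* s ℕ.+ (k ℕ.* s ℕ.+ t)
      collect = solveℕ-∀

    -- The minimum zero condition puts the same power p^(v+r) into p^r S and into F; cancelling it
    -- from the congruence leaves the unit parts.
    minimum-zero-residue : ∀ N K r F → F ℕ.* K ! ≡ N ! → N ≡ K ℕ.+ r ℕ.* suc q →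
      stirling₁ (suc N) (suc K) ≢ 0ℤ →
      ν p (stirling₁ (suc N) (suc K)) ℕ.* suc q ℕ.+ σ p N ≡ σ p K →
      ε p (stirling₁ (suc N) (suc K)) ≡ ε p (+ F) * + (K C r) [modℤ p ]
    minimum-zero-residue N K r F F*K!≡N! N≡ S≢0 min =
      ∣ₚ⇒∣ (∣ₚ-cancelˡ (p^ w) p^w≢0 (subst₂ _∣ₚ_ divisor dividend residue))
      where
      open ≡-Reasoning
      S = stirling₁ (suc N) (suc K)
      v = ν p S
      w = v ℕ.+ r
      c = + (K C r)
      F≢0 : F ≢ 0
      F≢0 refl = contradiction (sym F*K!≡N!) (ℕ.≢-nonZero⁻¹ (N !) {{N ℕₚ.!≢0}})
      p^w≢0 : p^ w ≢ 0ℤ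
      p^w≢0 e = contradiction (+-injective e) (ℕ.≢-nonZero⁻¹ (p ℕ.^ w) {{ℕₚ.m^n≢0 p w}})
      K!≢0 : fact K ≢ 0ℤ
      K!≢0 e = contradiction (+-injective e) (ℕ.≢-nonZero⁻¹ (K !) {{K ℕₚ.!≢0}})
      -- Cancelling K! turns the modulus p N! into p F.
      residue : + p * + F ∣ₚ p^ r * S - + F * c
      residue = ∣ₚ-cancelˡ (fact K) K!≢0 (subst₂ _∣ₚ_
        (trans (cong (+ p *_) N!≡) (pull-divisor (+ p) (+ F) (fact K)))
        (trans (cong (λ x → p^ r * (fact K * S) - x * c) N!≡) (pull-dividend (p^ r) (fact K) S (+ F) c))
        (stirling₁-residue K r N N≡))
        where
        N!≡ : fact N ≡ + F * fact K
        N!≡ = trans (cong +_ (sym F*K!≡N!)) (pos-* F (K !))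
        pull-divisor : ∀ p f k → p * (f * k) ≡ k * (p * f)
        pull-divisor = solve-∀
        pull-dividend : ∀ P k s f c → P * (k * s) - (f * k) * c ≡ k * (P * s - f * c)
        pull-dividend = solve-∀
      F≡ : + F ≡ ε p (+ F) * p^ w
      F≡ = trans (ε*p^ν (+ F) (λ e → F≢0 (+-injective e)))
                 (cong (λ x → ε p (+ F) * p^ x) (ν-factorial-quotient {r = r} {v = v} F≢0 F*K!≡N! N≡ min))
      divisor : + p * + F ≡ p^ w * (+ p * ε p (+ F))
      divisor = trans (cong (+ p *_) F≡) (rotate (+ p) (ε p (+ F)) (p^ w))
        where
        rotate : ∀ p e P → p * (e * P) ≡ P * (p * e)
        rotate = solve-∀
      dividend : p^ r * S - + F * c ≡ p^ w * (ε p S - ε p (+ F) * c)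
      dividend = begin
        p^ r * S - + F * c                                  ≡⟨ cong₂ (λ x y → p^ r * x - y * c) (ε*p^ν S S≢0) F≡ ⟩
        p^ r * (ε p S * p^ v) - (ε p (+ F) * p^ w) * c      ≡⟨ cong (_- (ε p (+ F) * p^ w) * c) (trans (rotate (p^ r) (ε p S) (p^ v)) (cong (_* ε p S) (sym (p^-+ v r)))) ⟩
        p^ w * ε p S - (ε p (+ F) * p^ w) * c               ≡⟨ factor (p^ w) (ε p S) (ε p (+ F)) c ⟩
        p^ w * (ε p S - ε p (+ F) * c)                      ∎
        where
        rotate : ∀ R e V → R * (e * V) ≡ (V * R) * e
        rotate = solve-∀
        factor : ∀ P x y c → P * x - (y * P) * c ≡ P * (x - y * c)
        factor = solve-∀

-- Specialisation to p = q + 2, n = N + 1, k = K + 1.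

open import Data.Nat using (ℕ; zero; suc; s≤s; _+_; _*_; _∸_; _≤_; _!; _/_)
open import Data.Nat.Properties using (_!≢0; m+[n∸m]≡n)
open import Data.Nat.Combinatorics using (_C_)
open import Data.Nat.Divisibility using (m≤n⇒m!∣n!)
open import Data.Nat.DivMod using (m/n*n≡m)
open import Data.Nat.Primality using (Prime; ¬prime[0]; ¬prime[1])
open import Data.Integer using (+_) renaming (_*_ to _*ℤ_)
open import Relation.Binary.PropositionalEquality using (_≡_; _≢_; sym; trans; cong)
open import Relation.Nullary using (contradiction)
open import Data.Product using (_×_; _,_)
open Congruences using (module Local)

theorem3p1 : (p n k : ℕ) → Prime p → 1 ≤ k → k ≤ n →
    stirling₁ n k ≢ + 0 →
    ν p (stirling₁ n k) * (p ∸ 1) + σ p (n ∸ 1) ≡ σ p (k ∸ 1) →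
    (r : ℕ) → r * (p ∸ 1) ≡ n ∸ k →
    (ν p (stirling₁ n k) * (p ∸ 1) + σ p (n ∸ 1) ≡ σ p (k ∸ 1))
    × (ε p (stirling₁ n k) ≡ ε p (+ (((n ∸ 1) ! / (k ∸ 1) !) {{(k ∸ 1) !≢0}})) *ℤ (+ ((k ∸ 1) C r)) [modℤ p ])
theorem3p1 zero _ _ p-prime _ _ _ _ _ _ = contradiction p-prime ¬prime[0]
theorem3p1 (suc zero) _ _ p-prime _ _ _ _ _ _ = contradiction p-prime ¬prime[1]
theorem3p1 (suc (suc q)) (suc N) (suc K) p-prime _ (s≤s K≤N) S≢0 min r r*[p-1]≡N-K =
  min , Local.minimum-zero-residue q p-prime N K r ((N ! / K !) {{K !≢0}})
          -- As K! divides N!, the quotient of natural numbers is exact and serves as F.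
          (m/n*n≡m {{K !≢0}} (m≤n⇒m!∣n! K≤N))
          (trans (sym (m+[n∸m]≡n K≤N)) (cong (λ d → K + d) (sym r*[p-1]≡N-K)))
          S≢0 min
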